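{- Let $d\ge 1$ and let $w$ be an infinite $d$-ary word. Let $\Delta_w$ denote the maximal degree of irrationality of the letters in $w$. Then, for every integer $n\geq 1$, $$p_w(n)\geq (\Delta_w-1)(n-1)+d.$$
   Context: An infinite $d$-ary word is a sequence $w\in\{1,\ldots,d\}^{\mathbb{N}}$ in which all $d$ letters actually occur. A factor of length $n$ of $w$ is a finite word of length $n$ that occurs in $w$ as a block of $n$ consecutive letters. $p_w(n)$ is the number of distinct factors of length $n$ of $w$ (in particular $p_w(0)=1$ and $p_w(1)=d$). For $n\geq 1$, $\mathrm{pref}_n(w)$ is the prefix of $w$ of length $n$, and $|u|_i$ is the number of occurrences of the letter $i$ in the finite word $u$. The letter frequencies of $w$ are not assumed to exist. Let $F_w\subseteq[0,1]^d$ be the set of all subsequential limits of the sequence $\left(\frac1n(|\mathrm{pref}_n(w)|_1,\ldots,|\mathrm{pref}_n(w)|_d)\right)_{n\ge 1}$, i.e. the set of $(f_1,\ldots,f_d)\in[0,1]^d$ for which there is an increasing sequence of integers $(n_l)_l$ with $|\mathrm{pref}_{n_l}(w)|_i/n_l\to f_i$ as $l\to\infty$ for every $i\in\{1,\ldots,d\}$. The maximal degree of irrationality of the letters in $w$ is $$\Delta_w:=\max\{\dim_{\mathbb{Q}}\mathrm{Span}_{\mathbb{Q}}(f_1,\ldots,f_d) : (f_1,\ldots,f_d)\in F_w\},$$ where $\mathrm{Span}_{\mathbb{Q}}(f_1,\ldots,f_d)\subseteq\mathbb{R}$ is the $\mathbb{Q}$-linear subspace of $\mathbb{R}$ generated by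 the real numbers $f_1,\ldots,f_d$. -}

module Defs where

open import Level using (0ℓ)
open import Algebra.Module.Bundles using (LeftModule)
import Algebra.Properties.Monoid.Sum as MonoidSum
open import Data.Fin.Base using (Fin; toℕ)
import Data.Fin.Properties as Fin
open import Data.Integer.Base using (+_)
open import Data.List.Base using (List; length)
open import Data.List.Membership.Propositional using () renaming (_∈_ to _∈ˡ_)
open import Data.List.Relation.Unary.Unique.Propositional using (Unique)
open import Data.Nat.Base as ℕ using (ℕ; suc)
import Data.Nat.Properties as ℕ
open import Data.Product.Base using (Σ; ∃; _×_; _,_; proj₁; proj₂)
open import Data.Rational.Base as ℚ using (ℚ; 0ℚ; 1ℚ; ½; _/_)
import Data.Rational.Properties as ℚ
open import Data.Rational.Solver using (module +-*-Solver)
open import Data.Vec.Base using (Vec; tabulate; count)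
open import Function.Base using (_∘_)
open import Function.Bundles using (_⇔_)
open import Relation.Binary.PropositionalEquality
  using (_≡_; refl; sym; trans; cong; cong₂; subst)
open import Relation.Unary using (Pred; _∈_)

-- The real numbers: Cauchy sequences of rationals, compared by a setoid
-- equality.

IsCauchy : (ℕ → ℚ) → Set
IsCauchy s = ∀ ε → 0ℚ ℚ.< ε →
  ∃ λ N → ∀ m n → N ℕ.≤ m → N ℕ.≤ n → ℚ.∣ s m ℚ.- s n ∣ ℚ.< ε

IsNull : (ℕ → ℚ) → Set
IsNull s = ∀ ε → 0ℚ ℚ.< ε → ∃ λ N → ∀ n → N ℕ.≤ n → ℚ.∣ s n ∣ ℚ.< ε

-- Without eta, comparing two reals does not unfold their Cauchy proofs.
record ℝ : Set where
  no-eta-equality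
  constructor mkℝ
  field
    approx : ℕ → ℚ
    cauchy : IsCauchy approx

open ℝ public

infix 4 _≈_ _≤_

-- Records rather than functions into Set, so that the two reals can be
-- inferred from the type.
record _≈_ (x y : ℝ) : Set where
  constructor mk≈
  field
    null : IsNull (λ n → approx x n ℚ.- approx y n)

open _≈_ public

record _≤_ (x y : ℝ) : Set where
  constructor mk≤
  field
    bound : ∀ ε → 0ℚ ℚ.< ε →
      ∃ λ N → ∀ n → N ℕ.≤ n → approx x n ℚ.≤ approx y n ℚ.+ ε

open _≤_ public

open +-*-Solver using (solve; _:+_; _:*_; _:-_; _:=_; :-_)

half-pos : ∀ {ε} → 0ℚ ℚ.< ε → 0ℚ ℚ.< ½ ℚ.* ε
half-pos {ε} p = subst (ℚ._< ½ ℚ.* ε) (ℚ.*-zeroʳ ½) (ℚ.*-monoʳ-<-pos ½ p)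

halves : ∀ ε → ½ ℚ.* ε ℚ.+ ½ ℚ.* ε ≡ ε
halves ε = trans (sym (ℚ.*-distribʳ-+ ε ½ ½)) (ℚ.*-identityˡ ε)

∣+∣< : ∀ {ε} p q → ℚ.∣ p ∣ ℚ.< ½ ℚ.* ε → ℚ.∣ q ∣ ℚ.< ½ ℚ.* ε → ℚ.∣ p ℚ.+ q ∣ ℚ.< ε
∣+∣< {ε} p q a b = ℚ.≤-<-trans (ℚ.∣p+q∣≤∣p∣+∣q∣ p q)
  (subst (ℚ.∣ p ∣ ℚ.+ ℚ.∣ q ∣ ℚ.<_) (halves ε) (ℚ.+-mono-< a b))

scale : ℚ → ℚ
scale c = 1ℚ ℚ.+ ℚ.∣ c ∣

scale-pos : ∀ c → ℚ.Positive (scale c)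
scale-pos c = ℚ.pos+nonNeg⇒pos 1ℚ ℚ.∣ c ∣ {{ℚ.nonNegative (ℚ.0≤∣p∣ c)}}

shrink : ℚ → ℚ → ℚ
shrink c ε = (ℚ.1/ scale c) {{ℚ.pos⇒nonZero (scale c) {{scale-pos c}}}} ℚ.* ε

shrink-pos : ∀ c {ε} → 0ℚ ℚ.< ε → 0ℚ ℚ.< shrink c ε
shrink-pos c {ε} p = subst (ℚ._< shrink c ε) (ℚ.*-zeroʳ r) (ℚ.*-monoʳ-<-pos r {{rp}} p)
  where
  r = (ℚ.1/ scale c) {{ℚ.pos⇒nonZero (scale c) {{scale-pos c}}}}
  rp = ℚ.1/pos⇒pos (scale c) {{scale-pos c}}

scale-shrink : ∀ c ε → scale c ℚ.* shrink c ε ≡ ε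
scale-shrink c ε = trans (sym (ℚ.*-assoc (scale c) _ ε))
  (trans (cong (ℚ._* ε) (ℚ.*-inverseʳ (scale c) {{ℚ.pos⇒nonZero (scale c) {{scale-pos c}}}}))
         (ℚ.*-identityˡ ε))

∣*∣< : ∀ {ε} c p → ℚ.∣ p ∣ ℚ.< shrink c ε → ℚ.∣ c ℚ.* p ∣ ℚ.< ε
∣*∣< {ε} c p a = subst (ℚ._< ε) (sym (ℚ.∣p*q∣≡∣p∣*∣q∣ c p))
  (ℚ.≤-<-trans
    (ℚ.*-monoʳ-≤-nonNeg ℚ.∣ p ∣ {{ℚ.nonNegative (ℚ.0≤∣p∣ p)}} ∣c∣≤)
    (subst (scale c ℚ.* ℚ.∣ p ∣ ℚ.<_) (scale-shrink c ε)
      (ℚ.*-monoʳ-<-pos (scale c) {{scale-pos c}} a)))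
  where
  ∣c∣≤ : ℚ.∣ c ∣ ℚ.≤ scale c
  ∣c∣≤ = subst (ℚ._≤ scale c) (ℚ.+-identityˡ ℚ.∣ c ∣)
    (ℚ.+-monoˡ-≤ ℚ.∣ c ∣ (ℚ.nonNegative⁻¹ 1ℚ))

≡⇒∣-∣≡0 : ∀ {p q} → p ≡ q → ℚ.∣ p ℚ.- q ∣ ≡ 0ℚ
≡⇒∣-∣≡0 {p} refl = cong ℚ.∣_∣ (ℚ.+-inverseʳ p)

reverse-triangle : ∀ p q → ℚ.∣ ℚ.∣ p ∣ ℚ.- ℚ.∣ q ∣ ∣ ℚ.≤ ℚ.∣ p ℚ.- q ∣
reverse-triangle p q = case (ℚ.∣p∣≡p∨∣p∣≡-p d)
  where
  open import Data.Sum.Base using (_⊎_; inj₁; inj₂)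
  d = ℚ.∣ p ∣ ℚ.- ℚ.∣ q ∣
  one-sided : ∀ a b → ℚ.∣ a ∣ ℚ.- ℚ.∣ b ∣ ℚ.≤ ℚ.∣ a ℚ.- b ∣
  one-sided a b = subst (ℚ.∣ a ∣ ℚ.- ℚ.∣ b ∣ ℚ.≤_)
    (solve 2 (λ x y → (x :+ y) :- y := x) refl ℚ.∣ a ℚ.- b ∣ ℚ.∣ b ∣)
    (ℚ.+-monoˡ-≤ (ℚ.- ℚ.∣ b ∣)
      (subst (λ t → ℚ.∣ t ∣ ℚ.≤ ℚ.∣ a ℚ.- b ∣ ℚ.+ ℚ.∣ b ∣)
        (solve 2 (λ x y → (x :- y) :+ y := x) refl a b)
        (ℚ.∣p+q∣≤∣p∣+∣q∣ (a ℚ.- b) b)))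
  ∣-∣-comm : ∀ a b → ℚ.∣ a ℚ.- b ∣ ≡ ℚ.∣ b ℚ.- a ∣
  ∣-∣-comm a b = trans (sym (ℚ.∣-p∣≡∣p∣ (a ℚ.- b)))
    (cong ℚ.∣_∣ (solve 2 (λ x y → :- (x :- y) := y :- x) refl a b))
  case : (ℚ.∣ d ∣ ≡ d) ⊎ (ℚ.∣ d ∣ ≡ ℚ.- d) → ℚ.∣ d ∣ ℚ.≤ ℚ.∣ p ℚ.- q ∣
  case (inj₁ e) = subst (ℚ._≤ ℚ.∣ p ℚ.- q ∣) (sym e) (one-sided p q)
  case (inj₂ e) = subst (ℚ._≤ ℚ.∣ p ℚ.- q ∣)
    (sym (trans e (solve 2 (λ x y → :- (x :- y) := y :- x) refl ℚ.∣ p ∣ ℚ.∣ q ∣)))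
    (subst (ℚ.∣ q ∣ ℚ.- ℚ.∣ p ∣ ℚ.≤_) (∣-∣-comm q p) (one-sided q p))

null-cong : ∀ {s t} → (∀ n → s n ≡ t n) → IsNull s → IsNull t
null-cong e h ε p = proj₁ (h ε p) , λ n N≤n →
  subst (λ q → ℚ.∣ q ∣ ℚ.< ε) (e n) (proj₂ (h ε p) n N≤n)

null-+ : ∀ {s t} → IsNull s → IsNull t → IsNull (λ n → s n ℚ.+ t n)
null-+ {s} {t} h k ε p with h _ (half-pos p) | k _ (half-pos p)
... | N , a | M , b = N ℕ.⊔ M , λ n le → ∣+∣< (s n) (t n)
  (a n (ℕ.≤-trans (ℕ.m≤m⊔n N M) le)) (b n (ℕ.≤-trans (ℕ.m≤n⊔m N M) le))

null-* : ∀ c {s} → IsNull s → IsNull (λ n → c ℚ.* s n)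
null-* c {s} h ε p = proj₁ tail , λ n le → ∣*∣< {ε} c (s n) (proj₂ tail n le)
  where tail = h (shrink c ε) (shrink-pos c p)

null-neg : ∀ {s} → IsNull s → IsNull (λ n → ℚ.- s n)
null-neg {s} h ε p with h ε p
... | N , a = N , λ n le → subst (ℚ._< ε) (sym (ℚ.∣-p∣≡∣p∣ (s n))) (a n le)

ι : ℚ → ℝ
ι q = mkℝ (λ _ → q) λ ε p → 0 , λ _ _ _ _ → subst (ℚ._< ε) (sym (≡⇒∣-∣≡0 {q} refl)) p

infixl 6 _+_ _-_
infixr 7 _*ₗ_
infix  8 -_

_+_ : ℝ → ℝ → ℝ
approx (x + y) n = approx x n ℚ.+ approx y n
cauchy (x + y) ε p with cauchy x _ (half-pos p) | cauchy y _ (half-pos p)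
... | N , a | M , b = N ℕ.⊔ M , λ m n le le′ →
  subst (λ t → ℚ.∣ t ∣ ℚ.< ε)
    (solve 4 (λ p q r s → (p :- q) :+ (r :- s) := (p :+ r) :- (q :+ s)) refl
      (approx x m) (approx x n) (approx y m) (approx y n))
    (∣+∣< (approx x m ℚ.- approx x n) (approx y m ℚ.- approx y n)
      (a m n (ℕ.≤-trans (ℕ.m≤m⊔n N M) le) (ℕ.≤-trans (ℕ.m≤m⊔n N M) le′))
      (b m n (ℕ.≤-trans (ℕ.m≤n⊔m N M) le) (ℕ.≤-trans (ℕ.m≤n⊔m N M) le′)))

-_ : ℝ → ℝ
approx (- x) n = ℚ.- approx x n
cauchy (- x) ε p with cauchy x ε p
... | N , a = N , λ m n le le′ → subst (ℚ._< ε)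
  (trans (sym (ℚ.∣-p∣≡∣p∣ (approx x m ℚ.- approx x n)))
    (cong ℚ.∣_∣ (solve 2 (λ p q → :- (p :- q) := (:- p) :- (:- q)) refl
      (approx x m) (approx x n))))
  (a m n le le′)

_-_ : ℝ → ℝ → ℝ
x - y = x + (- y)

_*ₗ_ : ℚ → ℝ → ℝ
approx (c *ₗ x) n = c ℚ.* approx x n
cauchy (c *ₗ x) ε p = proj₁ tail , λ m n le le′ →
  subst (λ t → ℚ.∣ t ∣ ℚ.< ε)
    (solve 3 (λ c p q → c :* (p :- q) := c :* p :- c :* q) refl
      c (approx x m) (approx x n))
    (∣*∣< {ε} c (approx x m ℚ.- approx x n) (proj₂ tail m n le le′))
  where tail = cauchy x (shrink c ε) (shrink-pos c p)

∣_∣ : ℝ → ℝ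
approx ∣ x ∣ n = ℚ.∣ approx x n ∣
cauchy ∣ x ∣ ε p with cauchy x ε p
... | N , a = N , λ m n le le′ →
  ℚ.≤-<-trans (reverse-triangle (approx x m) (approx x n)) (a m n le le′)

pointwise : ∀ x y → (∀ n → approx x n ≡ approx y n) → x ≈ y
pointwise x y e = mk≈ λ ε p → 0 , λ n _ → subst (ℚ._< ε) (sym (≡⇒∣-∣≡0 (e n))) p

≈-refl : ∀ {x} → x ≈ x
≈-refl {x} = pointwise x x λ _ → refl

≈-sym : ∀ {x y} → x ≈ y → y ≈ x
≈-sym {x} {y} (mk≈ h) = mk≈ (null-cong
  (λ n → solve 2 (λ p q → :- (p :- q) := q :- p) refl (approx x n) (approx y n))
  (null-neg h))

≈-trans : ∀ {x y z} → x ≈ y → y ≈ z → x ≈ z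
≈-trans {x} {y} {z} (mk≈ h) (mk≈ k) = mk≈ (null-cong
  (λ n → solve 3 (λ p q r → (p :- q) :+ (q :- r) := p :- r) refl
    (approx x n) (approx y n) (approx z n))
  (null-+ h k))

+-cong : ∀ {x y u v} → x ≈ y → u ≈ v → x + u ≈ y + v
+-cong {x} {y} {u} {v} (mk≈ h) (mk≈ k) = mk≈ (null-cong
  (λ n → solve 4 (λ p q r s → (p :- q) :+ (r :- s) := (p :+ r) :- (q :+ s)) refl
    (approx x n) (approx y n) (approx u n) (approx v n))
  (null-+ h k))

neg-cong : ∀ {x y} → x ≈ y → - x ≈ - y
neg-cong {x} {y} (mk≈ h) = mk≈ (null-cong
  (λ n → solve 2 (λ p q → :- (p :- q) := (:- p) :- (:- q)) refl (approx x n) (approx y n))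
  (null-neg h))

*ₗ-cong : ∀ {c c′ x y} → c ≡ c′ → x ≈ y → c *ₗ x ≈ c′ *ₗ y
*ₗ-cong {c} {x = x} {y} refl (mk≈ h) = mk≈ (null-cong
  (λ n → solve 3 (λ c p q → c :* (p :- q) := c :* p :- c :* q) refl
    c (approx x n) (approx y n))
  (null-* c h))

ℝ-leftModule : LeftModule ℚ.+-*-ring 0ℓ 0ℓ
ℝ-leftModule = record
  { Carrierᴹ = ℝ
  ; _≈ᴹ_ = _≈_
  ; _+ᴹ_ = _+_
  ; _*ₗ_ = _*ₗ_
  ; 0ᴹ = ι 0ℚ
  ; -ᴹ_ = -_
  ; isLeftModule = record
    { isLeftSemimodule = record
      { +ᴹ-isCommutativeMonoid = record
        { isMonoid = record
          { isSemigroup = record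
            { isMagma = record
              { isEquivalence = record { refl = ≈-refl ; sym = ≈-sym ; trans = ≈-trans }
              ; ∙-cong = +-cong
              }
            ; assoc = λ x y z → pointwise ((x + y) + z) (x + (y + z)) λ n →
                ℚ.+-assoc (approx x n) (approx y n) (approx z n)
            }
          ; identity = (λ x → pointwise (ι 0ℚ + x) x λ n → ℚ.+-identityˡ (approx x n))
                     , (λ x → pointwise (x + ι 0ℚ) x λ n → ℚ.+-identityʳ (approx x n))
          }
        ; comm = λ x y → pointwise (x + y) (y + x) λ n → ℚ.+-comm (approx x n) (approx y n)
        }
      ; isPreleftSemimodule = record
        { *ₗ-cong = *ₗ-cong
        ; *ₗ-zeroˡ = λ x → pointwise (0ℚ *ₗ x) (ι 0ℚ) λ n → ℚ.*-zeroˡ (approx x n)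
        ; *ₗ-distribʳ = λ x c c′ → pointwise ((c ℚ.+ c′) *ₗ x) (c *ₗ x + c′ *ₗ x) λ n →
            ℚ.*-distribʳ-+ (approx x n) c c′
        ; *ₗ-identityˡ = λ x → pointwise (1ℚ *ₗ x) x λ n → ℚ.*-identityˡ (approx x n)
        ; *ₗ-assoc = λ c c′ x → pointwise ((c ℚ.* c′) *ₗ x) (c *ₗ (c′ *ₗ x)) λ n →
            ℚ.*-assoc c c′ (approx x n)
        ; *ₗ-zeroʳ = λ c → pointwise (c *ₗ ι 0ℚ) (ι 0ℚ) λ _ → ℚ.*-zeroʳ c
        ; *ₗ-distribˡ = λ c x y → pointwise (c *ₗ (x + y)) (c *ₗ x + c *ₗ y) λ n →
            ℚ.*-distribˡ-+ c (approx x n) (approx y n)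
        }
      }
    ; -ᴹ‿cong = neg-cong
    ; -ᴹ‿inverse = (λ x → pointwise (- x + x) (ι 0ℚ) λ n → ℚ.+-inverseˡ (approx x n))
                 , (λ x → pointwise (x - x) (ι 0ℚ) λ n → ℚ.+-inverseʳ (approx x n))
    }
  }

module RationalSpace {m ℓ} (V : LeftModule ℚ.+-*-ring m ℓ) where
  open LeftModule V using (Carrierᴹ; _≈ᴹ_; 0ᴹ; +ᴹ-monoid)
    renaming (_*ₗ_ to _·_)
  open MonoidSum +ᴹ-monoid using (sum)

  linearCombination : ∀ {k} → (Fin k → ℚ) → (Fin k → Carrierᴹ) → Carrierᴹ
  linearCombination c v = sum (λ i → c i · v i)

  Span : ∀ {k} → (Fin k → Carrierᴹ) → Pred Carrierᴹ ℓ
  Span v x = ∃ λ c → x ≈ᴹ linearCombination c v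

  LinearlyIndependent : ∀ {k} → (Fin k → Carrierᴹ) → Set ℓ
  LinearlyIndependent v =
    ∀ c → linearCombination c v ≈ᴹ 0ᴹ → ∀ i → c i ≡ 0ℚ

  -- Dimension as a relation: W has a basis with k elements.
  HasDimension : ∀ {ℓ′} → Pred Carrierᴹ ℓ′ → ℕ → Set _
  HasDimension W k = Σ (Fin k → Carrierᴹ) λ b →
    LinearlyIndependent b × (∀ x → x ∈ W ⇔ x ∈ Span b)

open RationalSpace ℝ-leftModule public

_⟶_ : (ℕ → ℚ) → ℝ → Set
q ⟶ x = ∀ ε → 0ℚ ℚ.< ε → ∃ λ N → ∀ l → N ℕ.≤ l → ∣ ι (q l) - x ∣ ≤ ι ε

-- Words are indexed from 0, and the letters 1, …, d are the elements of Fin d.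
record InfiniteWord (d : ℕ) : Set where
  field
    letter      : ℕ → Fin d
    all-letters : ∀ i → ∃ λ k → letter k ≡ i

open InfiniteWord public

block : ∀ {d} → InfiniteWord d → ℕ → (n : ℕ) → Vec (Fin d) n
block w k n = tabulate λ j → letter w (k ℕ.+ toℕ j)

Factor : ∀ {d} → InfiniteWord d → (n : ℕ) → Pred (Vec (Fin d) n) 0ℓ
Factor w n u = ∃ λ k → block w k n ≡ u

HasCardinality : ∀ {a ℓ} {A : Set a} → Pred A ℓ → ℕ → Set _
HasCardinality {A = A} P c = Σ (List A) λ xs →
  Unique xs × length xs ≡ c × (∀ x → x ∈ˡ xs ⇔ x ∈ P)

-- The number of factors of length n cannot be computed from w, so p_w(n) = c
-- is a relation between n and c.
Complexity : ∀ {d} → InfiniteWord d → ℕ → ℕ → Set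
Complexity w n c = HasCardinality (Factor w n) c

pref : ∀ {d} → InfiniteWord d → (n : ℕ) → Vec (Fin d) n
pref w n = block w 0 n

∣_∣[_] : ∀ {d n} → Vec (Fin d) n → Fin d → ℕ
∣ u ∣[ i ] = count (Fin._≟ i) u

prefixFrequency : ∀ {d} → InfiniteWord d → Fin d → (n : ℕ) → .{{ℕ.NonZero n}} → ℚ
prefixFrequency w i n = + ∣ pref w n ∣[ i ] / n

-- The set F_w.
LimitFrequencies : ∀ {d} → InfiniteWord d → Pred (Fin d → ℝ) 0ℓ
LimitFrequencies w f =
  (∀ i → (ι 0ℚ ≤ f i) × (f i ≤ ι 1ℚ)) ×
  Σ (ℕ → ℕ) λ n → Σ (∀ l → ℕ.NonZero (n l)) λ n≢0 →
    (∀ l → n l ℕ.< n (suc l)) ×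
    (∀ i → (λ l → prefixFrequency w i (n l) {{n≢0 l}}) ⟶ f i)

-- Δ_w = Δ, again as a relation: Δ is the greatest element of
-- { dim Span(f) : f ∈ F_w }.
MaxIrrationalityDegree : ∀ {d} → InfiniteWord d → ℕ → Set
MaxIrrationalityDegree w Δ =
  (∃ λ f → f ∈ LimitFrequencies w × HasDimension (Span f) Δ) ×
  (∀ f → f ∈ LimitFrequencies w → ∀ k → HasDimension (Span f) k → k ℕ.≤ Δ)

{-# OPTIONS --safe #-}

-- In the graph whose vertices and edges are the factors of lengths m and m + 1,
-- w is an infinite walk through all edges.  Let g₁, …, g_k be rational
-- combinations of the letter counts, with k > p(m+1) − p(m) + 1.  Asking that
-- Σ cⱼ gⱼ be the difference of a vertex potential h along every edge, with h
-- vanishing at the first vertex, is a homogeneous linear system in (c, h) with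
-- more unknowns than equations.  A nonzero solution has c ≠ 0, because h is
-- constant when c = 0, and then Σ cⱼ gⱼ telescopes to a bounded quantity along w.
-- Hence the limits of the frequencies of the gⱼ are dependent over ℚ, and so
-- Δ ≤ p(m+1) − p(m) + 1.  Summing over m gives the bound.

module Submission where

open import Defs
open import Data.Nat.Base as ℕ using (ℕ; zero; suc)
open import Data.Integer.Base as ℤ using (+_; 1ℤ)

open import Algebra.Bundles using (CommutativeRing)
import Algebra.Properties.Semiring.Sum as SemiringSum
open import Data.Bool.Base using (if_then_else_)
open import Data.Fin.Base using (Fin; zero; suc; toℕ; punchIn; splitAt; _↑ˡ_; _↑ʳ_)
import Data.Fin.Properties as Fin
import Data.Integer.Properties as ℤ
open import Data.Integer.Tactic.RingSolver using (solve-∀)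
open import Data.List.Base using (List; length; lookup; tabulate; deduplicate)
open import Data.List.Membership.Propositional using (_∈_)
open import Data.List.Membership.Propositional.Properties
  using (∈-lookup; ∈-tabulate⁺; ∈-tabulate⁻; ∈-deduplicate⁺; ∈-deduplicate⁻)
import Data.List.Relation.Unary.All as All
open import Data.List.Relation.Unary.AllPairs using (_∷_)
open import Data.List.Relation.Unary.Any using (index)
open import Data.List.Relation.Unary.Any.Properties using (lookup-index)
open import Data.List.Relation.Unary.Unique.Propositional using (Unique)
import Data.List.Relation.Unary.Unique.DecPropositional.Properties as Unique
import Data.Nat.Properties as ℕ
open import Data.Product.Base using (∃; _×_; _,_; proj₁; proj₂)
open import Data.Rational.Base as ℚ using (ℚ; mkℚ; 0ℚ; 1ℚ; ½; _/_)
import Data.Rational.Properties as ℚ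
open import Data.Rational.Solver using (module +-*-Solver)
open import Data.Rational.Unnormalised.Base as ℚᵘ using (mkℚᵘ)
import Data.Rational.Unnormalised.Properties as ℚᵘ
open import Data.Sum.Base using (inj₁; inj₂)
open import Data.Vec.Base as Vec using (Vec; _∷_)
import Data.Vec.Properties as Vec
open import Data.Vec.Functional as Vector using (Vector; insertAt; take; drop; _++_)
import Data.Vec.Functional.Properties as Vector
open import Function.Base using (_∘_)
open import Function.Bundles using (mk⇔; module Equivalence)
open import Function.Definitions using (Injective)
open import Relation.Nullary using (¬_; yes; no; does; contradiction)
open import Relation.Binary.PropositionalEquality
  using (_≡_; refl; sym; trans; cong; cong₂; subst; module ≡-Reasoning)

open +-*-Solver using (solve; _:+_; _:*_; _:-_; _:=_; :-_; con)
open SemiringSum (CommutativeRing.semiring ℚ.+-*-commutativeRing)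
  using (sum; sum-cong-≗; sum-remove; sum-replicate-zero; ∑-distrib-+; *-distribˡ-sum)

-- Linear algebra over ℚ

infix 8 _·_

_·_ : ∀ {n} → Vector ℚ n → Vector ℚ n → ℚ
u · v = sum λ i → u i ℚ.* v i

·-congʳ : ∀ {n} (u : Vector ℚ n) {v w} → (∀ i → v i ≡ w i) → u · v ≡ u · w
·-congʳ u e = sum-cong-≗ λ i → cong (u i ℚ.*_) (e i)

·-comm : ∀ {n} (u v : Vector ℚ n) → u · v ≡ v · u
·-comm u v = sum-cong-≗ λ i → ℚ.*-comm (u i) (v i)

·-zeroʳ : ∀ {n} (u : Vector ℚ n) → u · (λ _ → 0ℚ) ≡ 0ℚ
·-zeroʳ {n} u = trans (sum-cong-≗ λ i → ℚ.*-zeroʳ (u i)) (sum-replicate-zero n)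

·-+ʳ : ∀ {n} (u v w : Vector ℚ n) → u · (λ i → v i ℚ.+ w i) ≡ u · v ℚ.+ u · w
·-+ʳ u v w = trans (sum-cong-≗ λ i → ℚ.*-distribˡ-+ (u i) (v i) (w i))
  (∑-distrib-+ (λ i → u i ℚ.* v i) (λ i → u i ℚ.* w i))

·-*ʳ : ∀ {n} (u : Vector ℚ n) p v → u · (λ i → p ℚ.* v i) ≡ p ℚ.* u · v
·-*ʳ u p v = trans
  (sum-cong-≗ λ i → solve 3 (λ a b c → a :* (b :* c) := b :* (a :* c)) refl (u i) p (v i))
  (sym (*-distribˡ-sum p λ i → u i ℚ.* v i))

·-linearˡ : ∀ {n} p q (u v w : Vector ℚ n) →
  (λ i → p ℚ.* u i ℚ.+ q ℚ.* v i) · w ≡ p ℚ.* u · w ℚ.+ q ℚ.* v · w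
·-linearˡ p q u v w = begin
  (λ i → p ℚ.* u i ℚ.+ q ℚ.* v i) · w                    ≡⟨ ·-comm _ w ⟩
  w · (λ i → p ℚ.* u i ℚ.+ q ℚ.* v i)                    ≡⟨ ·-+ʳ w _ _ ⟩
  w · (λ i → p ℚ.* u i) ℚ.+ w · (λ i → q ℚ.* v i)        ≡⟨ cong₂ ℚ._+_ (·-*ʳ w p u) (·-*ʳ w q v) ⟩
  p ℚ.* w · u ℚ.+ q ℚ.* w · v                            ≡⟨ cong₂ (λ a b → p ℚ.* a ℚ.+ q ℚ.* b) (·-comm w u) (·-comm w v) ⟩
  p ℚ.* u · w ℚ.+ q ℚ.* v · w                            ∎
  where open ≡-Reasoning

sum-take-drop : ∀ m {n} (u : Vector ℚ (m ℕ.+ n)) → sum u ≡ sum (take m u) ℚ.+ sum (drop m u)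
sum-take-drop zero    u = sym (ℚ.+-identityˡ (sum u))
sum-take-drop (suc m) u = trans (cong (u zero ℚ.+_) (sum-take-drop m (u ∘ suc)))
  (sym (ℚ.+-assoc (u zero) _ _))

·-++ : ∀ {m n} (u : Vector ℚ m) (v : Vector ℚ n) x →
  (u ++ v) · x ≡ u · take m x ℚ.+ v · drop m x
·-++ {m} u v x = trans (sum-take-drop m _) (cong₂ ℚ._+_
  (sum-cong-≗ λ i → cong (ℚ._* x (i ↑ˡ _)) (Vector.lookup-++ˡ u v i))
  (sum-cong-≗ λ i → cong (ℚ._* x (m ↑ʳ i)) (Vector.lookup-++ʳ u v i)))

-- The standard basis vector. Branching on the Boolean `does` alone lets `δ (suc i) ∘ suc` reduce to
-- `δ i`, on which the induction in `δ-·` rests.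
δ : ∀ {n} → Fin n → Vector ℚ n
δ i j = if does (i Fin.≟ j) then 1ℚ else 0ℚ

δ-· : ∀ {n} (i : Fin n) x → δ i · x ≡ x i
δ-· {suc n} zero    x = begin
  1ℚ ℚ.* x zero ℚ.+ (λ _ → 0ℚ) · (x ∘ suc)  ≡⟨ cong (1ℚ ℚ.* x zero ℚ.+_) (trans (·-comm _ (x ∘ suc)) (·-zeroʳ (x ∘ suc))) ⟩
  1ℚ ℚ.* x zero ℚ.+ 0ℚ                      ≡⟨ ℚ.+-identityʳ _ ⟩
  1ℚ ℚ.* x zero                             ≡⟨ ℚ.*-identityˡ _ ⟩
  x zero                                    ∎
  where open ≡-Reasoning
δ-· {suc n} (suc i) x = begin
  0ℚ ℚ.* x zero ℚ.+ δ i · (x ∘ suc)  ≡⟨ cong₂ ℚ._+_ (ℚ.*-zeroˡ (x zero)) (δ-· i (x ∘ suc)) ⟩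
  0ℚ ℚ.+ x (suc i)                   ≡⟨ ℚ.+-identityˡ _ ⟩
  x (suc i)                          ∎
  where open ≡-Reasoning

*-cancelˡ-≡0 : ∀ {p q} → ¬ (p ≡ 0ℚ) → p ℚ.* q ≡ 0ℚ → q ≡ 0ℚ
*-cancelˡ-≡0 {p} {q} p≢0 pq≡0 = begin
  q                  ≡⟨ ℚ.*-identityˡ q ⟨
  1ℚ ℚ.* q           ≡⟨ cong (ℚ._* q) (ℚ.*-inverseˡ p) ⟨
  p⁻¹ ℚ.* p ℚ.* q    ≡⟨ ℚ.*-assoc p⁻¹ p q ⟩
  p⁻¹ ℚ.* (p ℚ.* q)  ≡⟨ cong (p⁻¹ ℚ.*_) pq≡0 ⟩
  p⁻¹ ℚ.* 0ℚ         ≡⟨ ℚ.*-zeroʳ p⁻¹ ⟩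
  0ℚ                 ∎
  where
  open ≡-Reasoning
  instance p-nonZero = ℚ.≢-nonZero p≢0
  p⁻¹ = ℚ.1/ p

≢0⇒nonzero-entry : ∀ {n} (u : Vector ℚ n) → ¬ (∀ i → u i ≡ 0ℚ) → ∃ λ i → ¬ (u i ≡ 0ℚ)
≢0⇒nonzero-entry u = Fin.¬∀⟶∃¬ _ (λ i → u i ≡ 0ℚ) (λ i → u i ℚ.≟ 0ℚ)

-- Gaussian elimination, by induction on the number of equations. A zero first row is dropped;
-- otherwise one of its nonzero entries serves as pivot, and cross-multiplication removes that
-- unknown from the other rows without any division.
underdetermined⇒kernel : ∀ {m n} → m ℕ.< n → (a : Fin m → Vector ℚ n) →
  ∃ λ x → ¬ (∀ i → x i ≡ 0ℚ) × (∀ r → a r · x ≡ 0ℚ)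
underdetermined⇒kernel {zero}  {suc n} _   a = (λ _ → 1ℚ) , (λ x≡0 → contradiction (x≡0 zero) λ ()) , λ ()
underdetermined⇒kernel {suc m} {suc n} m<n a with Fin.all? (λ i → a zero i ℚ.≟ 0ℚ)
... | yes a₀≡0 = x , x≢0 , λ
  { zero    → trans (·-comm (a zero) x) (trans (·-congʳ x a₀≡0) (·-zeroʳ x))
  ; (suc r) → ax≡0 r }
  where
  ker  = underdetermined⇒kernel (ℕ.<-trans (ℕ.n<1+n m) m<n) (a ∘ suc)
  x    = proj₁ ker
  x≢0  = proj₁ (proj₂ ker)
  ax≡0 = proj₂ (proj₂ ker)
... | no a₀≢0 = x , x≢0 , λ
  { zero    → trans (row zero) (solve 2 (λ p q → p :* (:- q) :+ p :* q := con 0ℚ) refl pivot (rest zero · y))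
  ; (suc r) → trans (row (suc r)) (trans
      (solve 4 (λ p q b c → b :* (:- q) :+ p :* c := p :* c :+ (:- b) :* q) refl
        pivot (rest zero · y) (a (suc r) i) (rest (suc r) · y))
      (trans (sym (·-linearˡ pivot (ℚ.- a (suc r) i) (rest (suc r)) (rest zero) y)) (by≡0 r))) }
  where
  i = proj₁ (≢0⇒nonzero-entry (a zero) a₀≢0)
  pivot = a zero i
  rest : Fin (suc m) → Vector ℚ n
  rest r = a r ∘ punchIn i
  ker = underdetermined⇒kernel (ℕ.≤-pred m<n)
    (λ r j → pivot ℚ.* rest (suc r) j ℚ.+ (ℚ.- a (suc r) i) ℚ.* rest zero j)
  y    = proj₁ ker
  by≡0 = proj₂ (proj₂ ker)
  -- Scaling the reduced solution by the pivot lets the pivot coordinate `- (rest zero · y)` solve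
  -- row `zero`, again without dividing.
  y′ = λ j → pivot ℚ.* y j
  x = insertAt y′ i (ℚ.- (rest zero · y))
  x≢0 : ¬ (∀ j → x j ≡ 0ℚ)
  x≢0 x≡0 = proj₁ (proj₂ ker) λ j → *-cancelˡ-≡0 (proj₂ (≢0⇒nonzero-entry (a zero) a₀≢0))
    (trans (sym (Vector.insertAt-punchIn y′ i _ j)) (x≡0 (punchIn i j)))
  row : ∀ r → a r · x ≡ a r i ℚ.* (ℚ.- (rest zero · y)) ℚ.+ pivot ℚ.* rest r · y
  row r = begin
    a r · x                                             ≡⟨ sum-remove {i = i} (λ j → a r j ℚ.* x j) ⟩
    a r i ℚ.* x i ℚ.+ rest r · (x ∘ punchIn i)          ≡⟨ cong₂ (λ p q → a r i ℚ.* p ℚ.+ q)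
                                                              (Vector.insertAt-lookup y′ i _)
                                                              (·-congʳ (rest r) (Vector.insertAt-punchIn y′ i _)) ⟩
    a r i ℚ.* (ℚ.- (rest zero · y)) ℚ.+ rest r · y′     ≡⟨ cong (a r i ℚ.* (ℚ.- (rest zero · y)) ℚ.+_) (·-*ʳ (rest r) pivot y) ⟩
    a r i ℚ.* (ℚ.- (rest zero · y)) ℚ.+ pivot ℚ.* rest r · y  ∎
    where open ≡-Reasoning

take-drop-≡0 : ∀ m {n} (x : Vector ℚ (m ℕ.+ n)) →
  (∀ i → take m x i ≡ 0ℚ) → (∀ i → drop m x i ≡ 0ℚ) → ∀ i → x i ≡ 0ℚ
take-drop-≡0 m {n} x x₁≡0 x₂≡0 i with splitAt m i | Fin.join-splitAt m n i
... | inj₁ j | refl = x₁≡0 j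
... | inj₂ j | refl = x₂≡0 j

-- Null sequences and limits

-- A limit in `ℝ` becomes a statement about rationals only, pairing each term with the approximation
-- of the same index. The two are compared through `approx x k`, where `k` may depend on `l`.
⟶⇒null : ∀ {q x} → q ⟶ x → IsNull (λ l → q l ℚ.- approx x l)
⟶⇒null {q} {x} q⟶x ε ε>0 = N ℕ.⊔ M , close
  where
  -- One ε/4 is for the limit and one for the tolerance in the definition of ≤ on ℝ.
  ε/2 = ½ ℚ.* ε
  ε/4 = ½ ℚ.* ε/2
  ε/4>0 : 0ℚ ℚ.< ε/4
  ε/4>0 = half-pos (half-pos ε>0)
  lim = q⟶x ε/4 ε/4>0
  N = proj₁ lim
  cau = cauchy x ε/2 (half-pos ε>0)
  M = proj₁ cau
  close : ∀ l → N ℕ.⊔ M ℕ.≤ l → ℚ.∣ q l ℚ.- approx x l ∣ ℚ.< ε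
  close l N⊔M≤l = begin-strict
    ℚ.∣ q l ℚ.- approx x l ∣
      ≡⟨ cong ℚ.∣_∣ (solve 3 (λ a b c → a :- b := (a :- c) :+ (c :- b)) refl (q l) (approx x l) (approx x k)) ⟩
    ℚ.∣ (q l ℚ.- approx x k) ℚ.+ (approx x k ℚ.- approx x l) ∣
      ≤⟨ ℚ.∣p+q∣≤∣p∣+∣q∣ (q l ℚ.- approx x k) (approx x k ℚ.- approx x l) ⟩
    ℚ.∣ q l ℚ.- approx x k ∣ ℚ.+ ℚ.∣ approx x k ℚ.- approx x l ∣
      <⟨ ℚ.+-mono-≤-< (proj₂ near k (ℕ.m≤m⊔n K M)) (proj₂ cau k l (ℕ.m≤n⊔m K M) (ℕ.≤-trans (ℕ.m≤n⊔m N M) N⊔M≤l)) ⟩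
    (ε/4 ℚ.+ ε/4) ℚ.+ ε/2
      ≡⟨ cong (ℚ._+ ε/2) (halves ε/2) ⟩
    ε/2 ℚ.+ ε/2
      ≡⟨ halves ε ⟩
    ε ∎
    where
    open ℚ.≤-Reasoning
    near = bound (proj₂ lim l (ℕ.≤-trans (ℕ.m≤m⊔n N M) N⊔M≤l)) ε/4 ε/4>0
    K = proj₁ near
    k = K ℕ.⊔ M

null-· : ∀ {n} (c : Vector ℚ n) {s : Fin n → ℕ → ℚ} →
  (∀ i → IsNull (s i)) → IsNull (λ l → c · (λ i → s i l))
null-· {zero}  c h ε ε>0 = 0 , λ _ _ → ε>0
null-· {suc n} c h = null-+ (null-* (c zero) (h zero)) (null-· (c ∘ suc) (h ∘ suc))

null-dominated : ∀ {s t} → (∀ n → ℚ.∣ s n ∣ ℚ.≤ t n) → IsNull t → IsNull s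
null-dominated {s} {t} s≤t h ε ε>0 = proj₁ (h ε ε>0) , λ n N≤n →
  ℚ.≤-<-trans (ℚ.≤-trans (s≤t n) (p≤∣p∣ (t n))) (proj₂ (h ε ε>0) n N≤n)
  where
  p≤∣p∣ : ∀ p → p ℚ.≤ ℚ.∣ p ∣
  p≤∣p∣ p with ℚ.≤-total 0ℚ p
  ... | inj₁ 0≤p = ℚ.≤-reflexive (sym (ℚ.0≤p⇒∣p∣≡p 0≤p))
  ... | inj₂ p≤0 = ℚ.≤-trans p≤0 (ℚ.0≤∣p∣ p)

approx-linearCombination : ∀ {n} (c : Vector ℚ n) (x : Fin n → ℝ) l →
  approx (linearCombination c x) l ≡ c · (λ i → approx (x i) l)
approx-linearCombination {zero}  c x l = refl
approx-linearCombination {suc n} c x l =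
  cong (c zero ℚ.* approx (x zero) l ℚ.+_) (approx-linearCombination (c ∘ suc) (x ∘ suc) l)

null-linearCombination : ∀ {n} (c : Vector ℚ n) {s : Fin n → ℕ → ℚ} {x : Fin n → ℝ} →
  (∀ i → IsNull (λ l → s i l ℚ.- approx (x i) l)) →
  IsNull (λ l → c · (λ i → s i l) ℚ.- approx (linearCombination c x) l)
null-linearCombination c {s} {x} h = null-cong difference (null-· c h)
  where
  open ≡-Reasoning
  difference : ∀ l → c · (λ i → s i l ℚ.- approx (x i) l) ≡
    c · (λ i → s i l) ℚ.- approx (linearCombination c x) l
  difference l = begin
    c · (λ i → s i l ℚ.- approx (x i) l)
      ≡⟨ ·-congʳ c (λ i → solve 2 (λ a b → a :- b := a :+ con (ℚ.- 1ℚ) :* b) refl (s i l) (approx (x i) l)) ⟩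
    c · (λ i → s i l ℚ.+ ℚ.- 1ℚ ℚ.* approx (x i) l)
      ≡⟨ ·-+ʳ c _ _ ⟩
    c · (λ i → s i l) ℚ.+ c · (λ i → ℚ.- 1ℚ ℚ.* approx (x i) l)
      ≡⟨ cong (c · (λ i → s i l) ℚ.+_) (·-*ʳ c (ℚ.- 1ℚ) _) ⟩
    c · (λ i → s i l) ℚ.+ ℚ.- 1ℚ ℚ.* c · (λ i → approx (x i) l)
      ≡⟨ cong (λ t → c · (λ i → s i l) ℚ.+ ℚ.- 1ℚ ℚ.* t) (approx-linearCombination c x l) ⟨
    c · (λ i → s i l) ℚ.+ ℚ.- 1ℚ ℚ.* approx (linearCombination c x) l
      ≡⟨ solve 2 (λ a b → a :+ con (ℚ.- 1ℚ) :* b := a :- b) refl (c · (λ i → s i l)) _ ⟩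
    c · (λ i → s i l) ℚ.- approx (linearCombination c x) l ∎

toℚᵘ-/ : ∀ i n → ℚ.toℚᵘ (i / suc n) ℚᵘ.≃ mkℚᵘ i n
toℚᵘ-/ i n = ℚ.toℚᵘ-fromℚᵘ (mkℚᵘ i n)

1/-null : IsNull (λ n → + 1 / suc n)
-- `b` is the denominator minus one, so `ε = (a + 1) / (b + 1)` is at least `1 / (b + 1)`, which
-- exceeds `1 / (n + 1)` once `n ≥ b + 1`.
1/-null ε@(mkℚ (+ suc a) b _) _ = suc b , λ n b<n →
  subst (ℚ._< ε) (sym (ℚ.0≤p⇒∣p∣≡p (ℚ.nonNegative⁻¹ (+ 1 / suc n) {{ℚ.normalize-nonNeg 1 (suc n)}})))
    (ℚ.toℚᵘ-cancel-< (ℚᵘ.<-respˡ-≃ (ℚᵘ.≃-sym (toℚᵘ-/ (+ 1) n))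
      (ℚᵘ.*<* (ℤ.+<+ (ℕ.≤-trans (ℕ.s≤s (ℕ.≤-trans (ℕ.≤-reflexive (ℕ.+-identityʳ (suc b))) b<n))
        (ℕ.m≤m+n (suc n) (a ℕ.* suc n)))))))
1/-null (mkℚ (+ zero)     _ _) (ℚ.*<* (ℤ.+<+ ()))
1/-null (mkℚ (ℤ.-[1+ _ ]) _ _) (ℚ.*<* ())

-- Factors and letter counts

lookup-injective : ∀ {a} {A : Set a} {xs : List A} → Unique xs →
  ∀ {i j} → lookup xs i ≡ lookup xs j → i ≡ j
lookup-injective (x∉xs ∷ xs!) {zero}  {zero}  _  = refl
lookup-injective (x∉xs ∷ xs!) {zero}  {suc j} eq = contradiction eq (All.lookup x∉xs (∈-lookup j))
lookup-injective (x∉xs ∷ xs!) {suc i} {zero}  eq = contradiction (sym eq) (All.lookup x∉xs (∈-lookup i))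
lookup-injective (x∉xs ∷ xs!) {suc i} {suc j} eq = cong suc (lookup-injective xs! eq)

module _ {d} (w : InfiniteWord d) where

  block-suc : ∀ k n → block w k (suc n) ≡ letter w k ∷ block w (suc k) n
  block-suc k n = cong₂ _∷_ (cong (letter w) (ℕ.+-identityʳ k))
    (Vec.tabulate-cong λ j → cong (letter w) (ℕ.+-suc k (toℕ j)))

  -- Together with `block-tail` and `block-init`: an edge determines its letter, its target and its
  -- source, so an equation at one occurrence of an edge transfers to all others.
  block-head : ∀ {k l} n → block w k (suc n) ≡ block w l (suc n) → letter w k ≡ letter w l
  block-head {k} {l} n e = Vec.∷-injectiveˡ (trans (sym (block-suc k n)) (trans e (block-suc l n)))

  block-tail : ∀ {k l} n → block w k (suc n) ≡ block w l (suc n) →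
    block w (suc k) n ≡ block w (suc l) n
  block-tail {k} {l} n e = Vec.∷-injectiveʳ (trans (sym (block-suc k n)) (trans e (block-suc l n)))

  block-init : ∀ {k l} n → block w k (suc n) ≡ block w l (suc n) → block w k n ≡ block w l n
  block-init         zero    e = refl
  block-init {k} {l} (suc n) e = begin
    block w k (suc n)               ≡⟨ block-suc k n ⟩
    letter w k ∷ block w (suc k) n  ≡⟨ cong₂ _∷_ (block-head (suc n) e) (block-init n (block-tail (suc n) e)) ⟩
    letter w l ∷ block w (suc l) n  ≡⟨ block-suc l n ⟨
    block w l (suc n)               ∎
    where open ≡-Reasoning

  -- The equivalence "same factor of length n" on positions, with its quotient Fin p.
  record FactorIndexing (n p : ℕ) : Set where
    field
      rep       : Fin p → ℕ
      idx       : ℕ → Fin p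
      idx-rep   : ∀ i → idx (rep i) ≡ i
      idx-cong  : ∀ {k l} → block w k n ≡ block w l n → idx k ≡ idx l
      block-rep : ∀ k → block w (rep (idx k)) n ≡ block w k n

  -- Positions in the list of factors serve as the quotient. The index of a factor comes from a
  -- membership proof; uniqueness makes `lookup` injective, so equal factors get equal indices
  -- whatever the proofs.
  complexity⇒indexing : ∀ {n p} → Complexity w n p → FactorIndexing n p
  complexity⇒indexing {n} (xs , xs! , refl , xs↔factors) = record
    { rep       = rep
    ; idx       = idx
    ; idx-rep   = λ i → lookup-injective xs! (trans (lookup-idx (rep i)) (block-lookup i))
    ; idx-cong  = λ {k} {l} e → lookup-injective xs! (trans (lookup-idx k) (trans e (sym (lookup-idx l))))
    ; block-rep = λ k → trans (block-lookup (idx k)) (lookup-idx k)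
    }
    where
    occurrence : ∀ i → ∃ λ k → block w k n ≡ lookup xs i
    occurrence i = Equivalence.to (xs↔factors _) (∈-lookup i)
    rep = proj₁ ∘ occurrence
    block-lookup = proj₂ ∘ occurrence
    member : ∀ k → block w k n ∈ xs
    member k = Equivalence.from (xs↔factors _) (k , refl)
    idx = index ∘ member
    lookup-idx : ∀ k → lookup xs (idx k) ≡ block w k n
    lookup-idx k = sym (lookup-index (member k))

  -- Complexity is a relation, so the descent to shorter factors must produce its value. Every
  -- occurrence of a factor extends to the right in an infinite word, so truncating the listed
  -- longer factors reaches all shorter ones; duplicates are then removed.
  complexity-pred : ∀ {n p} → Complexity w (suc n) p → ∃ λ q → Complexity w n q
  complexity-pred {n} C = length ys , ys , Unique.deduplicate-! _≟_ inits , refl , λ u → mk⇔ factor (member u)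
    where
    open FactorIndexing (complexity⇒indexing C)
    _≟_ = Vec.≡-dec (Fin._≟_ {d})
    inits = tabulate λ i → block w (rep i) n
    ys = deduplicate _≟_ inits
    factor : ∀ {u} → u ∈ ys → Factor w n u
    factor u∈ys with ∈-tabulate⁻ (∈-deduplicate⁻ _≟_ inits u∈ys)
    ... | i , u≡ = rep i , sym u≡
    member : ∀ u → Factor w n u → u ∈ ys
    member _ (k , refl) = ∈-deduplicate⁺ _≟_
      (subst (_∈ inits) (block-init n (block-rep k)) (∈-tabulate⁺ (idx k)))

  -- Each letter is sent to the class of one of its occurrences; a block of length one determines
  -- its letter.
  letters≤complexity₁ : ∀ {p} → Complexity w 1 p → d ℕ.≤ p
  letters≤complexity₁ {p} C = Fin.injective⇒≤ {f = f} f-injective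
    where
    open FactorIndexing (complexity⇒indexing C)
    f : Fin d → Fin p
    f i = idx (proj₁ (all-letters w i))
    f-injective : Injective _≡_ _≡_ f
    f-injective {i} {j} fi≡fj = begin
      i           ≡⟨ proj₂ (all-letters w i) ⟨
      letter w k  ≡⟨ block-head 0 (begin
        block w k 1              ≡⟨ block-rep k ⟨
        block w (rep (idx k)) 1  ≡⟨ cong (λ v → block w (rep v) 1) fi≡fj ⟩
        block w (rep (idx l)) 1  ≡⟨ block-rep l ⟩
        block w l 1              ∎) ⟩
      letter w l  ≡⟨ proj₂ (all-letters w j) ⟩
      j           ∎
      where
      open ≡-Reasoning
      k = proj₁ (all-letters w i)
      l = proj₁ (all-letters w j)

  -- Σ cⱼ gⱼ is a coboundary on the graph with vertices Fin q and edges Fin p.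
  coboundary : ∀ {m p q} → FactorIndexing (suc m) p → (V : FactorIndexing m q) →
    let open FactorIndexing V using (idx) in
    ∀ {r} (g : Fin r → Vector ℚ d) → suc p ℕ.< r ℕ.+ q →
    ∃ λ (c : Vector ℚ r) → ∃ λ (h : Vector ℚ q) → ¬ (∀ j → c j ≡ 0ℚ) ×
      (∀ k → c · (λ j → g j (letter w k)) ≡ h (idx (suc k)) ℚ.- h (idx k))
  coboundary {m} {p} {q} E V {r} g p<r+q = c , h , c≢0 , along
    where
    open FactorIndexing E using () renaming (rep to edge; idx to edge-idx; block-rep to block-edge)
    open FactorIndexing V
    open ≡-Reasoning
    G : ℕ → Vector ℚ r
    G k j = g j (letter w k)
    -- Source minus target: with this sign, `G k · c + gradient k · h = 0` says that `c · G k` is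
    -- the increment of `h`.
    gradient : ℕ → Vector ℚ q
    gradient k v = 1ℚ ℚ.* δ (idx k) v ℚ.+ ℚ.- 1ℚ ℚ.* δ (idx (suc k)) v
    gradient-· : ∀ k h → gradient k · h ≡ h (idx k) ℚ.- h (idx (suc k))
    gradient-· k h = begin
      gradient k · h
        ≡⟨ ·-linearˡ 1ℚ (ℚ.- 1ℚ) (δ (idx k)) (δ (idx (suc k))) h ⟩
      1ℚ ℚ.* δ (idx k) · h ℚ.+ ℚ.- 1ℚ ℚ.* δ (idx (suc k)) · h
        ≡⟨ cong₂ (λ a b → 1ℚ ℚ.* a ℚ.+ ℚ.- 1ℚ ℚ.* b) (δ-· (idx k) h) (δ-· (idx (suc k)) h) ⟩
      1ℚ ℚ.* h (idx k) ℚ.+ ℚ.- 1ℚ ℚ.* h (idx (suc k))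
        ≡⟨ solve 2 (λ a b → con 1ℚ :* a :+ con (ℚ.- 1ℚ) :* b := a :- b) refl (h (idx k)) (h (idx (suc k))) ⟩
      h (idx k) ℚ.- h (idx (suc k)) ∎
    equations : Fin (suc p) → Vector ℚ (r ℕ.+ q)
    -- This normalisation excludes the solutions with `c = 0` and `h` a nonzero constant; it
    -- accounts for the extra one in `suc p`.
    equations zero    = (λ (_ : Fin r) → 0ℚ) ++ δ (idx 0)
    equations (suc e) = G (edge e) ++ gradient (edge e)
    kernel = underdetermined⇒kernel p<r+q equations
    x   = proj₁ kernel
    x≢0 = proj₁ (proj₂ kernel)
    c   = take r x
    h   = drop r x
    H : ℕ → ℚ
    H k = h (idx k)
    H-start : H 0 ≡ 0ℚ
    H-start = begin
      H 0                                  ≡⟨ ℚ.+-identityˡ _ ⟨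
      0ℚ ℚ.+ H 0                           ≡⟨ cong₂ ℚ._+_ (trans (·-comm _ c) (·-zeroʳ c)) (δ-· (idx 0) h) ⟨
      (λ _ → 0ℚ) · c ℚ.+ δ (idx 0) · h     ≡⟨ ·-++ (λ (_ : Fin r) → 0ℚ) (δ (idx 0)) x ⟨
      equations zero · x                   ≡⟨ proj₂ (proj₂ kernel) zero ⟩
      0ℚ                                   ∎
    along-edge : ∀ e → let l = edge e in c · G l ℚ.+ (H l ℚ.- H (suc l)) ≡ 0ℚ
    along-edge e = begin
      c · G l ℚ.+ (H l ℚ.- H (suc l))      ≡⟨ cong₂ ℚ._+_ (·-comm c (G l)) (sym (gradient-· l h)) ⟩
      G l · c ℚ.+ gradient l · h           ≡⟨ ·-++ (G l) (gradient l) x ⟨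
      equations (suc e) · x                ≡⟨ proj₂ (proj₂ kernel) (suc e) ⟩
      0ℚ                                   ∎
      where l = edge e
    -- The equations were imposed at one representative occurrence of each edge only; position `k`
    -- is compared with the representative of its own edge.
    along : ∀ k → c · G k ≡ H (suc k) ℚ.- H k
    along k = begin
      c · G k
        ≡⟨ solve 3 (λ a b c → a := (a :+ (b :- c)) :+ (c :- b)) refl (c · G k) (H k) (H (suc k)) ⟩
      (c · G k ℚ.+ (H k ℚ.- H (suc k))) ℚ.+ (H (suc k) ℚ.- H k)
        ≡⟨ cong (ℚ._+ (H (suc k) ℚ.- H k)) (trans transport-to-edge (along-edge (edge-idx k))) ⟩
      0ℚ ℚ.+ (H (suc k) ℚ.- H k)
        ≡⟨ ℚ.+-identityˡ _ ⟩
      H (suc k) ℚ.- H k ∎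
      where
      l = edge (edge-idx k)
      transport-to-edge : c · G k ℚ.+ (H k ℚ.- H (suc k)) ≡ c · G l ℚ.+ (H l ℚ.- H (suc l))
      transport-to-edge = sym (cong₂ ℚ._+_
        (cong (λ a → c · (λ j → g j a)) (block-head m (block-edge k)))
        (cong₂ (λ u v → h u ℚ.- h v) (idx-cong (block-init m (block-edge k)))
                                     (idx-cong (block-tail m (block-edge k)))))
    c≢0 : ¬ (∀ j → c j ≡ 0ℚ)
    -- Every vertex `v` is visited, at position `rep v`, so the vanishing of `H` along the walk
    -- forces `h` to vanish too.
    c≢0 c≡0 = x≢0 (take-drop-≡0 r x c≡0 λ v → trans (cong h (sym (idx-rep v))) (H≡0 (rep v)))
      where
      H≡0 : ∀ k → H k ≡ 0ℚ
      H≡0 zero    = H-start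
      H≡0 (suc k) = begin
        H (suc k)                      ≡⟨ solve 2 (λ a b → a := (a :- b) :+ b) refl (H (suc k)) (H k) ⟩
        (H (suc k) ℚ.- H k) ℚ.+ H k    ≡⟨ cong₂ ℚ._+_ (sym (along k)) (H≡0 k) ⟩
        c · G k ℚ.+ 0ℚ                 ≡⟨ ℚ.+-identityʳ _ ⟩
        c · G k                        ≡⟨ ·-comm c _ ⟩
        G k · c                        ≡⟨ ·-congʳ (G k) c≡0 ⟩
        G k · (λ _ → 0ℚ)               ≡⟨ ·-zeroʳ (G k) ⟩
        0ℚ                             ∎

-- Letter counts as rational vectors, and telescoping

letterCounts : ∀ {d n} → Vec (Fin d) n → Vector ℚ d
letterCounts u i = + ∣ u ∣[ i ] / 1

-- Isolates the factor `1 / suc n`, so that linearity of `·` turns a combination of frequencies into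
-- one of letter counts.
/-as-* : ∀ a n → + a / suc n ≡ + 1 / suc n ℚ.* (+ a / 1)
/-as-* a n = ℚ.toℚᵘ-injective (begin-equality
  ℚ.toℚᵘ (+ a / suc n)                              ≃⟨ toℚᵘ-/ (+ a) n ⟩
  mkℚᵘ (+ a) n                                      ≃⟨ ℚᵘ.*≡* (arith (+ a) (+ suc n)) ⟩
  mkℚᵘ (+ 1) n ℚᵘ.* mkℚᵘ (+ a) 0                    ≃⟨ ℚᵘ.*-cong (toℚᵘ-/ (+ 1) n) (toℚᵘ-/ (+ a) 0) ⟨
  ℚ.toℚᵘ (+ 1 / suc n) ℚᵘ.* ℚ.toℚᵘ (+ a / 1)        ≃⟨ ℚ.toℚᵘ-homo-* (+ 1 / suc n) (+ a / 1) ⟨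
  ℚ.toℚᵘ (+ 1 / suc n ℚ.* (+ a / 1))                ∎)
  where
  open ℚᵘ.≤-Reasoning
  arith : ∀ i j → i ℤ.* (j ℤ.* 1ℤ) ≡ (1ℤ ℤ.* i) ℤ.* j
  arith = solve-∀

suc-/1 : ∀ a → + suc a / 1 ≡ 1ℚ ℚ.+ (+ a / 1)
suc-/1 a = ℚ.toℚᵘ-injective (begin-equality
  ℚ.toℚᵘ (+ suc a / 1)               ≃⟨ toℚᵘ-/ (+ suc a) 0 ⟩
  mkℚᵘ (+ suc a) 0                   ≃⟨ ℚᵘ.*≡* (arith (+ a)) ⟩
  ℚ.toℚᵘ 1ℚ ℚᵘ.+ mkℚᵘ (+ a) 0        ≃⟨ ℚᵘ.+-congʳ (ℚ.toℚᵘ 1ℚ) (toℚᵘ-/ (+ a) 0) ⟨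
  ℚ.toℚᵘ 1ℚ ℚᵘ.+ ℚ.toℚᵘ (+ a / 1)    ≃⟨ ℚ.toℚᵘ-homo-+ 1ℚ (+ a / 1) ⟨
  ℚ.toℚᵘ (1ℚ ℚ.+ (+ a / 1))          ∎)
  where
  open ℚᵘ.≤-Reasoning
  arith : ∀ i → (1ℤ ℤ.+ i) ℤ.* 1ℤ ≡ (1ℤ ℤ.* 1ℤ ℤ.+ i ℤ.* 1ℤ) ℤ.* 1ℤ
  arith = solve-∀

letterCounts-∷ : ∀ {d n} a (u : Vec (Fin d) n) i → letterCounts (a ∷ u) i ≡ δ a i ℚ.+ letterCounts u i
letterCounts-∷ a u i with a Fin.≟ i
... | yes _ = suc-/1 ∣ u ∣[ i ]
... | no  _ = sym (ℚ.+-identityˡ _)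

·-letterCounts-∷ : ∀ {d n} (b : Vector ℚ d) a (u : Vec (Fin d) n) →
  b · letterCounts (a ∷ u) ≡ b a ℚ.+ b · letterCounts u
·-letterCounts-∷ b a u = begin
  b · letterCounts (a ∷ u)                  ≡⟨ ·-congʳ b (letterCounts-∷ a u) ⟩
  b · (λ i → δ a i ℚ.+ letterCounts u i)    ≡⟨ ·-+ʳ b (δ a) (letterCounts u) ⟩
  b · δ a ℚ.+ b · letterCounts u            ≡⟨ cong (ℚ._+ b · letterCounts u) (trans (·-comm b (δ a)) (δ-· a b)) ⟩
  b a ℚ.+ b · letterCounts u                ∎
  where open ≡-Reasoning

-- The start `k` is kept general because peeling off the first letter moves it to `suc k`; prefixes
-- are the case `k = 0`.
telescope : ∀ {d r} (w : InfiniteWord d) (g : Fin r → Vector ℚ d) (c : Vector ℚ r) (H : ℕ → ℚ) →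
  (∀ k → c · (λ j → g j (letter w k)) ≡ H (suc k) ℚ.- H k) →
  ∀ n k → c · (λ j → g j · letterCounts (block w k n)) ≡ H (k ℕ.+ n) ℚ.- H k
telescope w g c H step zero k = begin
  c · (λ j → g j · (λ _ → 0ℚ))  ≡⟨ ·-congʳ c (λ j → ·-zeroʳ (g j)) ⟩
  c · (λ _ → 0ℚ)                ≡⟨ ·-zeroʳ c ⟩
  0ℚ                            ≡⟨ ℚ.+-inverseʳ (H k) ⟨
  H k ℚ.- H k                   ≡⟨ cong (λ m → H m ℚ.- H k) (ℕ.+-identityʳ k) ⟨
  H (k ℕ.+ 0) ℚ.- H k           ∎
  where open ≡-Reasoning
telescope w g c H step (suc n) k = begin
  c · (λ j → g j · letterCounts (block w k (suc n)))
    ≡⟨ cong (λ u → c · (λ j → g j · letterCounts u)) (block-suc w k n) ⟩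
  c · (λ j → g j · letterCounts (letter w k ∷ block w (suc k) n))
    ≡⟨ ·-congʳ c (λ j → ·-letterCounts-∷ (g j) (letter w k) (block w (suc k) n)) ⟩
  c · (λ j → g j (letter w k) ℚ.+ g j · letterCounts (block w (suc k) n))
    ≡⟨ ·-+ʳ c _ _ ⟩
  c · (λ j → g j (letter w k)) ℚ.+ c · (λ j → g j · letterCounts (block w (suc k) n))
    ≡⟨ cong₂ ℚ._+_ (step k) (telescope w g c H step n (suc k)) ⟩
  (H (suc k) ℚ.- H k) ℚ.+ (H (suc k ℕ.+ n) ℚ.- H (suc k))
    ≡⟨ solve 3 (λ a b c → (a :- b) :+ (c :- a) := c :- b) refl (H (suc k)) (H k) (H (suc k ℕ.+ n)) ⟩
  H (suc k ℕ.+ n) ℚ.- H k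
    ≡⟨ cong (λ m → H m ℚ.- H k) (ℕ.+-suc k n) ⟨
  H (k ℕ.+ suc n) ℚ.- H k ∎
  where open ≡-Reasoning

-- Used to bound a potential on finitely many vertices, with the sum of absolute values in place of
-- a maximum.
∣entry∣≤sum : ∀ {n} (u : Vector ℚ n) i → ℚ.∣ u i ∣ ℚ.≤ sum (λ j → ℚ.∣ u j ∣)
∣entry∣≤sum {suc n} u i = begin
  ℚ.∣ u i ∣                                          ≡⟨ ℚ.+-identityʳ _ ⟨
  ℚ.∣ u i ∣ ℚ.+ 0ℚ                                   ≤⟨ ℚ.+-monoʳ-≤ ℚ.∣ u i ∣ (0≤sum (u ∘ punchIn i)) ⟩
  ℚ.∣ u i ∣ ℚ.+ sum (λ j → ℚ.∣ u (punchIn i j) ∣)    ≡⟨ sum-remove {i = i} (λ j → ℚ.∣ u j ∣) ⟨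
  sum (λ j → ℚ.∣ u j ∣)                              ∎
  where
  open ℚ.≤-Reasoning
  0≤sum : ∀ {n} (v : Vector ℚ n) → 0ℚ ℚ.≤ sum (λ j → ℚ.∣ v j ∣)
  0≤sum {zero}  v = ℚ.≤-refl
  0≤sum {suc n} v = ℚ.+-mono-≤ (ℚ.0≤∣p∣ (v zero)) (0≤sum (v ∘ suc))

-- Limits of frequencies and the dimension bound

null-subsequence : ∀ {s} (k : ℕ → ℕ) → (∀ l → l ℕ.≤ k l) → IsNull s → IsNull (s ∘ k)
null-subsequence k l≤k h ε ε>0 = proj₁ (h ε ε>0) , λ l N≤l →
  proj₂ (h ε ε>0) (k l) (ℕ.≤-trans N≤l (l≤k l))

module _ {d} (w : InfiniteWord d) where

  bounded-counts⇒null : ∀ {r} (g : Fin r → Vector ℚ d) (c : Vector ℚ r) M →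
    (∀ n → ℚ.∣ c · (λ j → g j · letterCounts (pref w n)) ∣ ℚ.≤ M) →
    IsNull (λ n → c · (λ j → g j · (λ i → prefixFrequency w i (suc n))))
  bounded-counts⇒null g c M bounded = null-dominated below (null-* M 1/-null)
    where
    open ℚ.≤-Reasoning
    S : ℕ → ℚ
    S n = c · (λ j → g j · letterCounts (pref w n))
    below : ∀ n → ℚ.∣ c · (λ j → g j · (λ i → prefixFrequency w i (suc n))) ∣ ℚ.≤ M ℚ.* (+ 1 / suc n)
    below n = begin
      ℚ.∣ c · (λ j → g j · (λ i → prefixFrequency w i (suc n))) ∣
        ≡⟨ cong ℚ.∣_∣ (·-congʳ c λ j → trans
             (·-congʳ (g j) λ i → /-as-* ∣ pref w (suc n) ∣[ i ] n)
             (·-*ʳ (g j) 1/n (letterCounts (pref w (suc n))))) ⟩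
      ℚ.∣ c · (λ j → 1/n ℚ.* g j · letterCounts (pref w (suc n))) ∣
        ≡⟨ cong ℚ.∣_∣ (·-*ʳ c 1/n _) ⟩
      ℚ.∣ 1/n ℚ.* S (suc n) ∣
        ≡⟨ ℚ.∣p*q∣≡∣p∣*∣q∣ 1/n (S (suc n)) ⟩
      ℚ.∣ 1/n ∣ ℚ.* ℚ.∣ S (suc n) ∣
        ≡⟨ cong (ℚ._* ℚ.∣ S (suc n) ∣) (ℚ.0≤p⇒∣p∣≡p (ℚ.nonNegative⁻¹ 1/n)) ⟩
      1/n ℚ.* ℚ.∣ S (suc n) ∣
        ≤⟨ ℚ.*-monoˡ-≤-nonNeg 1/n (bounded (suc n)) ⟩
      1/n ℚ.* M
        ≡⟨ ℚ.*-comm 1/n M ⟩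
      M ℚ.* 1/n ∎
      where
      1/n = + 1 / suc n
      instance 1/n-nonNeg = ℚ.normalize-nonNeg 1 (suc n)

  null-along-subsequence : ∀ {r} (g : Fin r → Vector ℚ d) (c : Vector ℚ r) →
    IsNull (λ n → c · (λ j → g j · (λ i → prefixFrequency w i (suc n)))) →
    (n : ℕ → ℕ) (n≢0 : ∀ l → ℕ.NonZero (n l)) → (∀ l → n l ℕ.< n (suc l)) →
    IsNull (λ l → c · (λ j → g j · (λ i → prefixFrequency w i (n l) {{n≢0 l}})))
  null-along-subsequence g c h n n≢0 n< = null-cong
    (λ l → reindex (n l) {{n≢0 l}})
    -- The null sequence `h` is indexed by length minus one, hence `pred`. Strict increase from a
    -- positive start gives `l < n l`, that is `l ≤ pred (n l)`.
    (null-subsequence (ℕ.pred ∘ n) (λ l → ℕ.≤-pred (ℕ.≤-trans (l<n l) (ℕ.≤-reflexive (sym (ℕ.suc-pred (n l) {{n≢0 l}}))))) h)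
    where
    reindex : ∀ m .{{_ : ℕ.NonZero m}} →
      c · (λ j → g j · (λ i → prefixFrequency w i (suc (ℕ.pred m)))) ≡
      c · (λ j → g j · (λ i → prefixFrequency w i m))
    reindex (suc m) = refl
    l<n : ∀ l → l ℕ.< n l
    l<n zero    = ℕ.>-nonZero⁻¹ (n zero) {{n≢0 zero}}
    l<n (suc l) = ℕ.≤-trans (ℕ.s≤s (l<n l)) (n< l)

  -- `b j` is the combination of the basis with coefficients `δ j`, so the equality of spans applies
  -- to it. The coefficients over `f` obtained here become the letter weights `g j`.
  basis-in-span : ∀ {f : Fin d → ℝ} {Δ} (D : HasDimension (Span f) Δ) j → Span f (proj₁ D j)
  basis-in-span (b , _ , span) j = Equivalence.from (span (b j)) (δ j , pointwise (b j) (linearCombination (δ j) b)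
    λ l → sym (trans (approx-linearCombination (δ j) b l) (δ-· j λ i → approx (b i) l)))

  dimension≤complexity-increment : ∀ {m p q} → FactorIndexing w (suc m) p → FactorIndexing w m q →
    ∀ {f Δ} → LimitFrequencies w f → HasDimension (Span f) Δ → Δ ℕ.+ q ℕ.≤ suc p
  dimension≤complexity-increment {m} {p} {q} E V {f} {Δ} (_ , n , n≢0 , n< , freq⟶f) D@(b , independent , _) =
    ℕ.≮⇒≥ too-many
    where
    too-many : ¬ (suc p ℕ.< Δ ℕ.+ q)
    too-many p<Δ+q = c≢0 (independent c (mk≈ combination-null))
      where
      open FactorIndexing V using (idx)
      g : Fin Δ → Vector ℚ d
      g j = proj₁ (basis-in-span D j)
      potential = coboundary w E V g p<Δ+q
      c   = proj₁ potential
      h   = proj₁ (proj₂ potential)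
      c≢0 = proj₁ (proj₂ (proj₂ potential))
      H : ℕ → ℚ
      H k = h (idx k)
      M = sum (λ v → ℚ.∣ h v ∣) ℚ.+ ℚ.∣ H 0 ∣
      freq : Fin d → ℕ → ℚ
      freq i l = prefixFrequency w i (n l) {{n≢0 l}}
      bounded : ∀ k → ℚ.∣ c · (λ j → g j · letterCounts (pref w k)) ∣ ℚ.≤ M
      bounded k = begin
        ℚ.∣ c · (λ j → g j · letterCounts (pref w k)) ∣
          ≡⟨ cong ℚ.∣_∣ (telescope w g c H (proj₂ (proj₂ (proj₂ potential))) k 0) ⟩
        ℚ.∣ H k ℚ.- H 0 ∣           ≤⟨ ℚ.∣p-q∣≤∣p∣+∣q∣ (H k) (H 0) ⟩
        ℚ.∣ H k ∣ ℚ.+ ℚ.∣ H 0 ∣     ≤⟨ ℚ.+-monoˡ-≤ ℚ.∣ H 0 ∣ (∣entry∣≤sum h (idx k)) ⟩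
        M                           ∎
        where open ℚ.≤-Reasoning
      -- `b j` equals the combination of `f` with coefficients `g j`, and the frequencies along `n`
      -- tend to `f`.
      limit-of-basis : ∀ j → IsNull (λ l → g j · (λ i → freq i l) ℚ.- approx (b j) l)
      limit-of-basis j = null-cong
        (λ l → solve 3 (λ s t u → (s :- t) :+ (:- (u :- t)) := s :- u) refl
          (g j · (λ i → freq i l)) (approx (linearCombination (g j) f) l) (approx (b j) l))
        (null-+ (null-linearCombination (g j) {freq} {f} (λ i → ⟶⇒null (freq⟶f i)))
                (null-neg (null (proj₂ (basis-in-span D j)))))
      -- One rational sequence is null, by boundedness of the counts, and also approaches the
      -- combination of the `b j`; hence that combination is zero, against independence.
      combination-null : IsNull (λ l → approx (linearCombination c b) l ℚ.- 0ℚ)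
      combination-null = null-cong
        (λ l → solve 2 (λ s t → s :+ (:- (s :- t)) := t :- con 0ℚ) refl
          (c · (λ j → g j · (λ i → freq i l))) (approx (linearCombination c b) l))
        (null-+ (null-along-subsequence g c (bounded-counts⇒null g c M bounded) n n≢0 n<)
                (null-neg (null-linearCombination c {x = b} limit-of-basis)))

  -- This is `(Δ - 1) * n + d ≤ p` with `n` moved across, which avoids truncated subtraction. Each
  -- induction step adds one increment of the complexity, and factors of length one start the
  -- induction.
  complexity-lower-bound : ∀ {f Δ} → LimitFrequencies w f → HasDimension (Span f) Δ →
    ∀ n {p} → Complexity w (suc n) p → n ℕ.* Δ ℕ.+ d ℕ.≤ p ℕ.+ n
  complexity-lower-bound f∈F D zero {p} C = ℕ.≤-trans (letters≤complexity₁ w C) (ℕ.m≤m+n p 0)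
  complexity-lower-bound {Δ = Δ} f∈F D (suc n) {p} C = begin
    Δ ℕ.+ n ℕ.* Δ ℕ.+ d      ≡⟨ ℕ.+-assoc Δ (n ℕ.* Δ) d ⟩
    Δ ℕ.+ (n ℕ.* Δ ℕ.+ d)    ≤⟨ ℕ.+-monoʳ-≤ Δ (complexity-lower-bound f∈F D n C′) ⟩
    Δ ℕ.+ (q ℕ.+ n)          ≡⟨ ℕ.+-assoc Δ q n ⟨
    Δ ℕ.+ q ℕ.+ n            ≤⟨ ℕ.+-monoˡ-≤ n (dimension≤complexity-increment
                                  (complexity⇒indexing w C) (complexity⇒indexing w C′) f∈F D) ⟩
    suc (p ℕ.+ n)            ≡⟨ ℕ.+-suc p n ⟨
    p ℕ.+ suc n              ∎
    where
    open ℕ.≤-Reasoning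
    q = proj₁ (complexity-pred w C)
    C′ = proj₂ (complexity-pred w C)

theorem3p1 : ∀ (d : ℕ) → 1 ℕ.≤ d → (w : InfiniteWord d) →
    ∀ (Δ : ℕ) → MaxIrrationalityDegree w Δ →
    ∀ (n : ℕ) → 1 ℕ.≤ n →
    ∀ (p : ℕ) → Complexity w n p →
    + p ℤ.≥ (+ Δ ℤ.- 1ℤ) ℤ.* (+ n ℤ.- 1ℤ) ℤ.+ + d
theorem3p1 d _ w Δ ((f , f∈F , D) , _) (suc n) _ p C = begin
  -- `n` is now the length minus one, and the solver sees `+ suc n` as `1ℤ + n`; subtracting `n` in
  -- the integers undoes the rearrangement of `complexity-lower-bound`.
  (+ Δ ℤ.- 1ℤ) ℤ.* (+ suc n ℤ.- 1ℤ) ℤ.+ + d    ≡⟨ expand (+ Δ) (+ n) (+ d) ⟩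
  + n ℤ.* + Δ ℤ.+ + d ℤ.- + n                  ≡⟨ cong (λ i → i ℤ.+ + d ℤ.- + n) (ℤ.pos-* n Δ) ⟨
  + (n ℕ.* Δ ℕ.+ d) ℤ.- + n                    ≤⟨ ℤ.+-monoˡ-≤ (ℤ.- + n) (ℤ.+≤+ (complexity-lower-bound w f∈F D n C)) ⟩
  + (p ℕ.+ n) ℤ.- + n                          ≡⟨ cancel (+ p) (+ n) ⟩
  + p                                          ∎
  where
  open ℤ.≤-Reasoning
  expand : ∀ x y z → (x ℤ.- 1ℤ) ℤ.* (1ℤ ℤ.+ y ℤ.- 1ℤ) ℤ.+ z ≡ y ℤ.* x ℤ.+ z ℤ.- y
  expand = solve-∀
  cancel : ∀ x y → x ℤ.+ y ℤ.- y ≡ x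
  cancel = solve-∀
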